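{- There is a deterministic online algorithm for the online firefighting game on cactus graphs that is $3$-competitive on all instances in which the number $f_i$ of firefighters available in each round $i$ is even.
   Context: Online firefighting game: an instance is $\mathcal{I} = (G, r, (f_i)_{i\ge 1})$, where $G$ is a finite undirected graph, $r \in V(G)$ is the fire source, and $f_i \ge 0$ are integers. The graph $G$ and $r$ are known to the algorithm in advance; $f_i$ is revealed only at the beginning of round $i$. Initially only $r$ is burning. In round $i$, after learning $f_i$, the algorithm assigns at most $f_i$ firefighters to vertices that are neither burning nor already protected (a protected vertex never burns); then the fire spreads from every burning vertex to all of its unprotected neighbours. A vertex is saved if it never burns. $\mathrm{ALG}(\mathcal{I})$ is the number of vertices saved by algorithm ALG, and $\mathrm{OPT}(\mathcal{I})$ the maximum number of vertices that can be saved by any strategy knowing the whole sequence $(f_i)$ in advance. An algorithm is $c$-competitive on a set of instances if $\mathrm{OPT}(\mathcal{I}) \le c\cdot \mathrm{ALG}(\mathcal{I})$ for every instance $\mathcal{I}$ in the set. A cactus graph is a graph in which every edge lies on at most one simple cycle. -}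

module Defs where

open import Data.Nat using (ℕ; zero; suc; _+_; _*_; _≤_)
open import Data.Bool using (Bool; true; false; not; _∧_; _∨_)
open import Data.Fin using (Fin; toℕ)
import Data.Fin.Subset
open import Data.Fin.Subset using (Subset; ⁅_⁆; _∪_; ∁; ∣_∣; _∈_; _∉_)
open import Data.Vec using (Vec; tabulate; lookup)
open import Data.List using (List; applyUpTo)
open import Data.Product using (Σ; ∃; _×_; _,_)
open import Data.Sum using (_⊎_)
open import Function.Definitions using (Injective)
open import Relation.Binary.PropositionalEquality using (_≡_)
open import Function.Bundles using (_⇔_)

record Graph (n : ℕ) : Set where
  field
    adj    : Fin n → Fin n → Bool
    sym    : ∀ u v → adj u v ≡ adj v u
    irrefl : ∀ v → adj v v ≡ false
open Graph public

Adj : ∀ {n} → Graph n → Fin n → Fin n → Set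
Adj G u v = adj G u v ≡ true

CycStep : ∀ {k} → Fin (3 + k) → Fin (3 + k) → Set
CycStep {k} i j = (suc (toℕ i) ≡ toℕ j) ⊎ (toℕ i ≡ 2 + k × toℕ j ≡ 0)

record SimpleCycle {n : ℕ} (G : Graph n) : Set where
  field
    k      : ℕ
    vs     : Fin (3 + k) → Fin n
    vs-inj : Injective _≡_ _≡_ vs
    closed : ∀ i j → CycStep i j → Adj G (vs i) (vs j)
open SimpleCycle public

EdgeOf : ∀ {n} {G : Graph n} → SimpleCycle G → Fin n → Fin n → Set
EdgeOf C x y = ∃ λ i → ∃ λ j → CycStep i j ×
  ((vs C i ≡ x × vs C j ≡ y) ⊎ (vs C i ≡ y × vs C j ≡ x))

SameCycle : ∀ {n} {G : Graph n} → SimpleCycle G → SimpleCycle G → Set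
SameCycle C D = ∀ x y → EdgeOf C x y ⇔ EdgeOf D x y

Cactus : ∀ {n} → Graph n → Set
Cactus G = ∀ (C D : SimpleCycle G) x y →
  Adj G x y → EdgeOf C x y → EdgeOf D x y → SameCycle C D

anyFin : ∀ {n} → (Fin n → Bool) → Bool
anyFin {zero}  p = false
anyFin {suc n} p = p Fin.zero ∨ anyFin (λ i → p (Fin.suc i))

record GameState (n : ℕ) : Set where
  constructor ⟨_,_⟩
  field
    burning   : Subset n
    protected : Subset n
open GameState public

step : ∀ {n} → Graph n → GameState n → Subset n → GameState n
step G ⟨ B , P ⟩ Q = ⟨ B ∪ spread , P' ⟩
  where
    P' = P ∪ Q
    spread = tabulate (λ v → not (lookup P' v) ∧ anyFin (λ u → lookup B u ∧ adj G u v))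

-- a strategy: σ t = set of vertices protected in round t + 1
Strategy : ℕ → Set
Strategy n = ℕ → Subset n

run : ∀ {n} → Graph n → Fin n → Strategy n → ℕ → GameState n
run G r σ zero    = ⟨ ⁅ r ⁆ , Data.Fin.Subset.⊥ ⟩
run G r σ (suc t) = step G (run G r σ t) (σ t)

-- firefighter sequence f : ℕ → ℕ with f t = f_{t+1} (rounds are 0-indexed here)
Legal : ∀ {n} → Graph n → Fin n → (ℕ → ℕ) → Strategy n → Set
Legal G r f σ = ∀ t →
  (∣ σ t ∣ ≤ f t) ×
  (∀ v → v ∈ σ t → (v ∉ burning (run G r σ t)) × (v ∉ protected (run G r σ t)))

-- number of vertices not burning after t rounds (non-increasing in t);
-- its eventual (minimal) value is the number of saved vertices
unburnt : ∀ {n} → Graph n → Fin n → Strategy n → ℕ → ℕ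
unburnt G r σ t = ∣ ∁ (burning (run G r σ t)) ∣

-- for non-increasing a, b : ℕ → ℕ this says exactly  lim a ≤ c * lim b
SavedLe : (ℕ → ℕ) → ℕ → (ℕ → ℕ) → Set
SavedLe a c b = ∀ t → ∃ λ s → a s ≤ c * b t

-- Deterministic online algorithms: know G and r in advance, and in round
-- t + 1 know only f_1 , … , f_{t+1} (their own earlier moves and the fire
-- are determined by these); output the set of vertices to protect.

OnlineAlg : Set
OnlineAlg = ∀ {n} → Graph n → Fin n → List ℕ → Subset n

play : OnlineAlg → ∀ {n} → Graph n → Fin n → (ℕ → ℕ) → Strategy n
play A G r f t = A G r (applyUpTo f (suc t))

{-# OPTIONS --safe #-}
module Submission where

-- Fix the breadth-first tree rooted at r and let T(p) be the subtree below p.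
-- Two different edges leaving T(p), other than those at p itself, would close up to
-- two different cycles through the tree edge above p; so in a cactus T(p) has at
-- most two vertices with a neighbour outside, and one pair of firefighters saves T(p)
-- as long as dist r p ≥ i in round i. The algorithm spends each pair on the T(p) that
-- adds the most unclaimed vertices.
--
-- If an offline strategy saves a vertex v of the component of r, then some tree
-- ancestor p of v is protected by it in a round i ≤ dist r p, for otherwise the fire
-- descends the tree path to v on schedule. Charge v to p. Every pair of round i of the
-- algorithm gained at least the part of T(p) that is never claimed, so the vertices
-- charged to the 2k firefighters of round i and never claimed number at most twice
-- the gain of round i. In total the offline strategy saves at most (1 + 2) times as much.

open import Defs renaming (sym to adj-sym)
open import Data.Bool using (Bool; true; false; not; _∧_; _∨_)
import Data.Bool.Properties as Bool
open import Data.Fin using (Fin; zero; suc; toℕ; fromℕ; _≟_)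
import Data.Fin.Properties as Fin
open import Data.Fin.Subset using (Subset; inside; outside; _∈_; _∉_; _⊆_; _∪_; _─_; ∁; ⁅_⁆; ⊥; ∣_∣)
open import Data.Fin.Subset.Properties
open import Data.List using (List; []; _∷_; length; lookup; _++_; allFin; applyDownFrom; reverse)
import Data.List.Properties as List
open import Data.List.Extrema.Nat using (argmax; f[xs]≤f[argmax])
import Data.List.Relation.Unary.All as All
import Data.List.Membership.Propositional as ListM
open import Data.List.Membership.Propositional.Properties using (∈-allFin; ∈-lookup; ∈-++⁻)
open import Data.List.Relation.Unary.Any using (here; there; any?)
open import Data.Nat using (ℕ; zero; suc; _+_; _*_; _∸_; _≤_; _<_; _≤?_; _<?_; z≤n; s≤s; s≤s⁻¹)
open import Data.Nat.Divisibility using (_∣_)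
open import Data.Nat.DivMod using (_/_; m/n*n≤m; m/n*n≡m)
open import Data.Nat.Properties hiding (_≟_)
open import Data.Product using (∃; _×_; _,_; proj₁; proj₂)
open import Data.Sum using (_⊎_; inj₁; inj₂; [_,_]′)
open import Data.Vec using ([]; _∷_; tabulate; here; there)
import Data.Vec as Vec
import Data.Vec.Properties as Vec
open import Function using (_∘_)
open import Function.Bundles using (Equivalence)
open import Relation.Binary.PropositionalEquality
open import Relation.Nullary using (¬_; Dec; yes; no; does; contradiction)
open import Relation.Nullary.Decidable using (_×-dec_; _⊎-dec_; ¬?; dec-true; decidable-stable)
open import Relation.Unary using (Decidable)

private
  variable
    n : ℕ

-- Counting in finite subsets.

subset : {P : Fin n → Set} → Decidable P → Subset n
subset P? = tabulate (does ∘ P?)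

∈-tabulate⁺ : ∀ (p : Fin n → Bool) {v} → p v ≡ true → v ∈ tabulate p
∈-tabulate⁺ p {v} e = Vec.lookup⇒[]= v _ (trans (Vec.lookup∘tabulate p v) e)

∈-tabulate⁻ : ∀ (p : Fin n → Bool) {v} → v ∈ tabulate p → p v ≡ true
∈-tabulate⁻ p {v} i = trans (sym (Vec.lookup∘tabulate p v)) (Vec.[]=⇒lookup i)

does⁻ : ∀ {A : Set} (A? : Dec A) → does A? ≡ true → A
does⁻ (yes a) _ = a

∈-subset⁺ : ∀ {P : Fin n → Set} (P? : Decidable P) {v} → P v → v ∈ subset P?
∈-subset⁺ P? {v} Pv = ∈-tabulate⁺ (does ∘ P?) (dec-true (P? v) Pv)

∈-subset⁻ : ∀ {P : Fin n → Set} (P? : Decidable P) {v} → v ∈ subset P? → P v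
∈-subset⁻ P? {v} i = does⁻ (P? v) (∈-tabulate⁻ (does ∘ P?) i)

∉-─ : ∀ (p q : Subset n) {v} → v ∈ p ─ q → v ∉ q
∉-─ (_ ∷ p) (inside  ∷ q) (there i) (there j) = ∉-─ p q i j
∉-─ (_ ∷ p) (outside ∷ q) (there i) (there j) = ∉-─ p q i j

∣∪∣≤ : ∀ (p q : Subset n) → ∣ p ∪ q ∣ ≤ ∣ p ∣ + ∣ q ∣
∣∪∣≤ []            []            = z≤n
∣∪∣≤ (outside ∷ p) (outside ∷ q) = ∣∪∣≤ p q
∣∪∣≤ (outside ∷ p) (inside  ∷ q) = ≤-trans (s≤s (∣∪∣≤ p q)) (≤-reflexive (sym (+-suc ∣ p ∣ ∣ q ∣)))
∣∪∣≤ (inside  ∷ p) (outside ∷ q) = s≤s (∣∪∣≤ p q)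
∣∪∣≤ (inside  ∷ p) (inside  ∷ q) = s≤s (≤-trans (∣∪∣≤ p q) (+-monoʳ-≤ ∣ p ∣ (n≤1+n ∣ q ∣)))

∣p∣+∣q─p∣≤∣p∪q∣ : ∀ (p q : Subset n) → ∣ p ∣ + ∣ q ─ p ∣ ≤ ∣ p ∪ q ∣
∣p∣+∣q─p∣≤∣p∪q∣ []            []            = z≤n
∣p∣+∣q─p∣≤∣p∪q∣ (outside ∷ p) (outside ∷ q) = ∣p∣+∣q─p∣≤∣p∪q∣ p q
∣p∣+∣q─p∣≤∣p∪q∣ (outside ∷ p) (inside  ∷ q) = ≤-trans (≤-reflexive (+-suc ∣ p ∣ _)) (s≤s (∣p∣+∣q─p∣≤∣p∪q∣ p q))
∣p∣+∣q─p∣≤∣p∪q∣ (inside  ∷ p) (_       ∷ q) = s≤s (∣p∣+∣q─p∣≤∣p∪q∣ p q)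

─-mono : ∀ {p q r s : Subset n} → p ⊆ q → s ⊆ r → p ─ r ⊆ q ─ s
─-mono {p = p} {r = r} p⊆q s⊆r i = x∈p∧x∉q⇒x∈p─q (p⊆q (p─q⊆p p r i)) (∉-─ p r i ∘ s⊆r)

⋃ : ∀ {m} → Subset m → (Fin m → Subset n) → Subset n
⋃ []            X = ⊥
⋃ (outside ∷ Q) X = ⋃ Q (X ∘ suc)
⋃ (inside  ∷ Q) X = X zero ∪ ⋃ Q (X ∘ suc)

∈-⋃⁺ : ∀ {m} {Q : Subset m} {X : Fin m → Subset n} {p v} → p ∈ Q → v ∈ X p → v ∈ ⋃ Q X
∈-⋃⁺ here                         j = x∈p∪q⁺ (inj₁ j)
∈-⋃⁺ {Q = outside ∷ Q} (there i) j = ∈-⋃⁺ i j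
∈-⋃⁺ {Q = inside  ∷ Q} (there i) j = x∈p∪q⁺ (inj₂ (∈-⋃⁺ i j))

k*∣⋃∣≤ : ∀ {m} k {D} (Q : Subset m) (X : Fin m → Subset n) →
         (∀ p → k * ∣ X p ∣ ≤ D) → k * ∣ ⋃ Q X ∣ ≤ ∣ Q ∣ * D
k*∣⋃∣≤ {n = n} k [] X h = ≤-reflexive (trans (cong (k *_) (∣⊥∣≡0 n)) (*-zeroʳ k))
k*∣⋃∣≤ k (outside ∷ Q) X h = k*∣⋃∣≤ k Q (X ∘ suc) (h ∘ suc)
k*∣⋃∣≤ k {D} (inside  ∷ Q) X h = begin
  k * ∣ X zero ∪ ⋃ Q (X ∘ suc) ∣               ≤⟨ *-monoʳ-≤ k (∣∪∣≤ (X zero) _) ⟩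
  k * (∣ X zero ∣ + ∣ ⋃ Q (X ∘ suc) ∣)         ≡⟨ *-distribˡ-+ k ∣ X zero ∣ _ ⟩
  k * ∣ X zero ∣ + k * ∣ ⋃ Q (X ∘ suc) ∣       ≤⟨ +-mono-≤ (h zero) (k*∣⋃∣≤ k Q (X ∘ suc) (h ∘ suc)) ⟩
  D + ∣ Q ∣ * D                                ∎
  where open ≤-Reasoning

-- The arithmetic of charging: at most `k * 2` offline firefighters are each charged at most a
-- `k`-th part of the gain `D`. Multiplying by `k` avoids division; for `k` zero nothing can be
-- cancelled, but then `Q` is empty.
∣⋃∣≤2*D : ∀ {m} k {D} (Q : Subset m) (X : Fin m → Subset n) → ∣ Q ∣ ≤ k * 2 →
         (∀ p → k * ∣ X p ∣ ≤ D) → ∣ ⋃ Q X ∣ ≤ 2 * D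
∣⋃∣≤2*D {n = n} zero Q X Q≤ h = ≤-trans (≤-reflexive (sym (*-identityˡ _)))
  (≤-trans (k*∣⋃∣≤ 1 Q X (λ p → ≤-trans (≤-reflexive (*-identityˡ _)) (∣p∣≤n (X p))))
  (≤-trans (*-monoˡ-≤ n Q≤) z≤n))
∣⋃∣≤2*D (suc k) {D} Q X Q≤ h = *-cancelˡ-≤ (suc k) (begin
  suc k * ∣ ⋃ Q X ∣   ≤⟨ k*∣⋃∣≤ (suc k) Q X h ⟩
  ∣ Q ∣ * D           ≤⟨ *-monoˡ-≤ D Q≤ ⟩
  suc k * 2 * D       ≡⟨ *-assoc (suc k) 2 D ⟩
  suc k * (2 * D)     ∎)
  where open ≤-Reasoning

-- Spread of the fire.

∨-true⁻ : ∀ a {b} → a ∨ b ≡ true → a ≡ true ⊎ b ≡ true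
∨-true⁻ true  e = inj₁ refl
∨-true⁻ false e = inj₂ e

∧-true⁻ : ∀ a {b} → a ∧ b ≡ true → a ≡ true × b ≡ true
∧-true⁻ true e = refl , e

anyFin⁺ : ∀ (p : Fin n → Bool) u → p u ≡ true → anyFin p ≡ true
anyFin⁺ p zero    e rewrite e = refl
anyFin⁺ p (suc u) e with p zero
... | true  = refl
... | false = anyFin⁺ (p ∘ suc) u e

anyFin⁻ : ∀ (p : Fin n → Bool) → anyFin p ≡ true → ∃ λ u → p u ≡ true
anyFin⁻ {suc n} p e with ∨-true⁻ (p zero) e
... | inj₁ e₀ = zero , e₀
... | inj₂ e₁ with anyFin⁻ (p ∘ suc) e₁
...   | u , eᵤ = suc u , eᵤ

∉⇒lookup : ∀ (p : Subset n) {v} → v ∉ p → Vec.lookup p v ≡ false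
∉⇒lookup p {v} v∉p with Vec.lookup p v in e
... | true  = contradiction (Vec.lookup⇒[]= v p e) v∉p
... | false = refl

module _ (G : Graph n) (r : Fin n) (σ : Strategy n) (t : ℕ) where

  private
    B P P⁺ : Subset n
    B  = burning (run G r σ t)
    P  = protected (run G r σ t)
    P⁺ = protected (run G r σ (suc t))

  ∈-burning-suc⁻ : ∀ {v} → v ∈ burning (run G r σ (suc t)) →
                   v ∈ B ⊎ (v ∉ P⁺ × ∃ λ u → u ∈ B × Adj G u v)
  ∈-burning-suc⁻ {v} i with x∈p∪q⁻ B _ i
  ... | inj₁ j = inj₁ j
  ... | inj₂ j with ∧-true⁻ (not (Vec.lookup P⁺ v)) (∈-tabulate⁻ _ j)
  ...   | e₁ , e₂ with anyFin⁻ _ e₂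
  ...     | u , e₃ with ∧-true⁻ (Vec.lookup B u) e₃
  ...       | e₄ , uv = inj₂ (unprotected , u , Vec.lookup⇒[]= u B e₄ , uv)
    where
    unprotected : v ∉ P⁺
    unprotected k with trans (sym (cong not (Vec.[]=⇒lookup k))) e₁
    ... | ()

  burning-suc : B ⊆ burning (run G r σ (suc t))
  burning-suc i = x∈p∪q⁺ (inj₁ i)

  burning-spread : ∀ {u v} → v ∉ P⁺ → u ∈ B → Adj G u v → v ∈ burning (run G r σ (suc t))
  burning-spread {u} v∉ i uv = x∈p∪q⁺ (inj₂ (∈-tabulate⁺ _
    (cong₂ _∧_ (cong not (∉⇒lookup P⁺ v∉))
      (anyFin⁺ _ u (cong₂ _∧_ (Vec.[]=⇒lookup i) uv)))))

module _ (G : Graph n) (r : Fin n) (σ : Strategy n) where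

  burning-mono : ∀ {s t} → s ≤ t → burning (run G r σ s) ⊆ burning (run G r σ t)
  burning-mono {s} {t} s≤t {v} i = subst (λ m → v ∈ burning (run G r σ m)) (m∸n+n≡m s≤t) (go (t ∸ s))
    where
    go : ∀ k → v ∈ burning (run G r σ (k + s))
    go zero    = i
    go (suc k) = burning-suc G r σ (k + s) (go k)

  protected⁻ : ∀ t {v} → v ∈ protected (run G r σ t) → ∃ λ s → s < t × v ∈ σ s
  protected⁻ zero i = contradiction i ∉⊥
  protected⁻ (suc t) i with x∈p∪q⁻ (protected (run G r σ t)) (σ t) i
  ... | inj₂ j = t , ≤-refl , j
  ... | inj₁ j with protected⁻ t j
  ...   | s , s<t , k = s , m≤n⇒m≤1+n s<t , k

-- Simple paths and the cycles that they close.

data Consec {A : Set} : List A → A → A → Set where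
  here  : ∀ {x y zs} → Consec (x ∷ y ∷ zs) x y
  there : ∀ {x y z zs} → Consec zs x y → Consec (z ∷ zs) x y

Consec-lookup : ∀ {A : Set} (zs : List A) i j → suc (toℕ i) ≡ toℕ j → Consec zs (lookup zs i) (lookup zs j)
Consec-lookup (x ∷ y ∷ zs) zero    (suc zero) e = here
Consec-lookup (x ∷ zs)     (suc i) (suc j)    e = there (Consec-lookup zs i j (suc-injective e))

Consec-index : ∀ {A : Set} {zs : List A} {x y} → Consec zs x y →
               ∃ λ i → ∃ λ j → suc (toℕ i) ≡ toℕ j × lookup zs i ≡ x × lookup zs j ≡ y
Consec-index here = zero , suc zero , refl , refl , refl
Consec-index (there c) with Consec-index c
... | i , j , e , ei , ej = suc i , suc j , cong suc e , ei , ej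

module _ (G : Graph n) where

  -- The list omits the start, so the vertices are `a ∷ as`, all of them in `S`. As an index it
  -- exposes the length of the path, on which closing it to a cycle depends.
  data SimplePath (S : Fin n → Set) : Fin n → List (Fin n) → Fin n → Set where
    end  : ∀ {a} → S a → SimplePath S a [] a
    cons : ∀ {a b c as} → S a → Adj G a b → a ListM.∉ b ∷ as →
           SimplePath S b as c → SimplePath S a (b ∷ as) c

  Connected : (Fin n → Set) → Fin n → Fin n → Set
  Connected S a b = ∃ λ as → SimplePath S a as b

  private
    variable
      S S′ : Fin n → Set
      a b c d v x : Fin n
      as bs zs : List (Fin n)

  vertices-in : SimplePath S a as b → x ListM.∈ a ∷ as → S x
  vertices-in (end s)        (here refl) = s
  vertices-in (cons s _ _ _) (here refl) = s
  vertices-in (cons _ _ _ π) (there i)   = vertices-in π i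

  last-in : SimplePath S a as b → S b
  last-in (end s)        = s
  last-in (cons _ _ _ π) = last-in π

  suffix : SimplePath S a as b → x ListM.∈ a ∷ as → Connected S x b
  suffix π              (here refl) = _ , π
  suffix (cons _ _ _ π) (there i)   = suffix π i

  -- If `a` already occurs on the path, the suffix that starts there is taken, so the result stays
  -- simple.
  connected-step : S a → Adj G a b → Connected S b c → Connected S a c
  connected-step {a = a} {b = b} s e (as , π) with any? (a ≟_) (b ∷ as)
  ... | yes i = suffix π i
  ... | no ¬i = _ , cons s e ¬i π

  join : (∀ {x} → S x → ¬ S′ x) → SimplePath S a as b → Adj G b c → SimplePath S′ c bs d →
         SimplePath (λ x → S x ⊎ S′ x) a (as ++ c ∷ bs) d
  join {S = S} {S′ = S′} disjoint = go
    where
    weaken : SimplePath S′ a as b → SimplePath (λ x → S x ⊎ S′ x) a as b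
    weaken (end s)         = end (inj₂ s)
    weaken (cons s e ∉a π) = cons (inj₂ s) e ∉a (weaken π)
    go : SimplePath S a as b → Adj G b c → SimplePath S′ c bs d →
         SimplePath (λ x → S x ⊎ S′ x) a (as ++ c ∷ bs) d
    go (end s) f ρ = cons (inj₁ s) f (disjoint s ∘ vertices-in ρ) (weaken ρ)
    go {a} (cons {as = as} s e ∉a π) f ρ = cons (inj₁ s) e
      (λ i → [ ∉a , disjoint s ∘ vertices-in ρ ]′ (∈-++⁻ (_ ∷ as) i)) (go π f ρ)

  lookup-injective : SimplePath S a as b → ∀ {i j} → lookup (a ∷ as) i ≡ lookup (a ∷ as) j → i ≡ j
  lookup-injective π              {zero}  {zero}  e = refl
  lookup-injective (cons _ _ ∉a π) {zero}  {suc j} e = contradiction (subst (ListM._∈ _) (sym e) (∈-lookup j)) ∉a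
  lookup-injective (cons _ _ ∉a π) {suc i} {zero}  e = contradiction (subst (ListM._∈ _) e (∈-lookup i)) ∉a
  lookup-injective (cons _ _ _ π) {suc i} {suc j} e = cong suc (lookup-injective π e)

  Consec-adj : SimplePath S a as b → ∀ {x y} → Consec (a ∷ as) x y → Adj G x y
  Consec-adj (cons _ e _ _) here      = e
  Consec-adj (cons _ _ _ π) (there c) = Consec-adj π c

  Consec-in : SimplePath S a as b → ∀ {x y} → Consec (a ∷ as) x y → S x × S y
  Consec-in π@(cons s _ _ _) here      = s , vertices-in π (there (here refl))
  Consec-in (cons _ _ _ π)   (there c) = Consec-in π c

  lookup-last : SimplePath S a as b → ∀ i → toℕ i ≡ length as → lookup (a ∷ as) i ≡ b
  lookup-last (end _)        zero    e = refl
  lookup-last (cons _ _ _ π) (suc i) e = lookup-last π i (suc-injective e)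

  -- The two entries displayed after `a` ensure the three vertices that a `SimpleCycle` needs.
  closePath : ∀ {y} → SimplePath S a (x ∷ y ∷ zs) b → Adj G b a → SimpleCycle G
  closePath {a = a} {x = x} {zs = zs} {b = b} {y = y} π ba = record
    { k      = length zs
    ; vs     = lookup (a ∷ x ∷ y ∷ zs)
    ; vs-inj = lookup-injective π
    ; closed = closed′
    }
    where
    closed′ : ∀ i j → CycStep i j → Adj G (lookup (a ∷ x ∷ y ∷ zs) i) (lookup (a ∷ x ∷ y ∷ zs) j)
    closed′ i j    (inj₁ e)       = Consec-adj π (Consec-lookup _ i j e)
    closed′ i zero (inj₂ (e , _)) = subst (λ z → Adj G z a) (sym (lookup-last π i e)) ba

  -- The edges of the cycle that closes a path from a to b, oriented along the path.
  Directed : Fin n → List (Fin n) → Fin n → Fin n → Fin n → Set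
  Directed a as b x y = Consec (a ∷ as) x y ⊎ (x ≡ b × y ≡ a)

  module _ {y} (π : SimplePath S a (x ∷ y ∷ zs) b) (ba : Adj G b a) where

    EdgeOf-closePath⁺ : ∀ {s t} → Directed a (x ∷ y ∷ zs) b s t → EdgeOf (closePath π ba) s t
    EdgeOf-closePath⁺ (inj₁ c) with Consec-index c
    ... | i , j , e , ei , ej = i , j , inj₁ e , inj₁ (ei , ej)
    EdgeOf-closePath⁺ (inj₂ (refl , refl)) = fromℕ _ , zero , inj₂ (Fin.toℕ-fromℕ _ , refl) ,
      inj₁ (lookup-last π (fromℕ _) (Fin.toℕ-fromℕ _) , refl)

    EdgeOf-closePath⁻ : ∀ {s t} → EdgeOf (closePath π ba) s t →
                        Directed a (x ∷ y ∷ zs) b s t ⊎ Directed a (x ∷ y ∷ zs) b t s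
    EdgeOf-closePath⁻ (i , j , st , o) with directed i j st
      where
      directed : ∀ i j → CycStep i j →
                 Directed a (x ∷ y ∷ zs) b (lookup (a ∷ x ∷ y ∷ zs) i) (lookup (a ∷ x ∷ y ∷ zs) j)
      directed i j    (inj₁ e)       = inj₁ (Consec-lookup _ i j e)
      directed i zero (inj₂ (e , _)) = inj₂ (lookup-last π i e , refl)
    EdgeOf-closePath⁻ (i , j , st , inj₁ (refl , refl)) | δ = inj₁ δ
    EdgeOf-closePath⁻ (i , j , st , inj₂ (refl , refl)) | δ = inj₂ δ

  Consec-join : SimplePath S a as b → ∀ c bs → Consec (a ∷ as ++ c ∷ bs) b c
  Consec-join (end _)        c bs = here
  Consec-join (cons _ _ _ π) c bs = there (Consec-join π c bs)

  -- Every step except the one over the joining edge stays within one of the two paths, and that one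
  -- starts at `b`.
  Consec-join⁻ : SimplePath S a as b → SimplePath S′ c bs d → ∀ {x y} → Consec (a ∷ as ++ c ∷ bs) x y →
                 x ≡ b ⊎ (S x × S y) ⊎ (S′ x × S′ y)
  Consec-join⁻ (end _)          ρ here      = inj₁ refl
  Consec-join⁻ (end _)          ρ (there c) = inj₂ (inj₂ (Consec-in ρ c))
  Consec-join⁻ π@(cons s _ _ _) ρ here      = inj₂ (inj₁ (s , vertices-in π (there (here refl))))
  Consec-join⁻ (cons _ _ _ π)   ρ (there c) = Consec-join⁻ π ρ c

  -- The field `crossings` names only the inner ends of crossing edges: uniqueness of an exit vertex
  -- is what will be drawn from the cactus property.
  record CrossingCycle (S : Fin n → Set) (p p′ v u : Fin n) : Set where
    field
      cycle     : SimpleCycle G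
      edge-p    : EdgeOf cycle p p′
      edge-v    : EdgeOf cycle u v
      crossings : ∀ {x y} → EdgeOf cycle x y → ¬ S x → S y → y ≡ p ⊎ y ≡ v

  -- The cycle runs from `v` to `p` inside `S`, over the edge to `p′`, on to `u` outside `S`, and
  -- back to `v`. Since `v ≢ p`, it has at least three vertices even when `p′` is `u`.
  crossingCycle : ∀ {p p′ v u} → v ≢ p → Connected S v p → Adj G p p′ →
                  Connected (λ x → ¬ S x) p′ u → Adj G u v → CrossingCycle S p p′ v u
  crossingCycle v≢p (_ , end _) _ _ _ = contradiction refl v≢p
  crossingCycle {S = S} {p} {p′} {v} {u} v≢p (b ∷ bs , π@(cons _ _ _ _)) pp′ (cs , ρ) uv =
    close bs (join (λ s ¬s → ¬s s) π pp′ ρ) (Consec-join π p′ cs) (Consec-join⁻ π ρ)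
    where
    closeWith : ∀ {y zs} → SimplePath (λ x → S x ⊎ ¬ S x) v (b ∷ y ∷ zs) u →
            Consec (v ∷ b ∷ y ∷ zs) p p′ →
            (∀ {x z} → Consec (v ∷ b ∷ y ∷ zs) x z → x ≡ p ⊎ (S x × S z) ⊎ (¬ S x × ¬ S z)) →
            CrossingCycle S p p′ v u
    closeWith {y} {zs} κ c split = record
      { cycle     = closePath κ uv
      ; edge-p    = EdgeOf-closePath⁺ κ uv (inj₁ c)
      ; edge-v    = EdgeOf-closePath⁺ κ uv (inj₂ (refl , refl))
      ; crossings = λ e → crossings (EdgeOf-closePath⁻ κ uv e)
      }
      where
      crossings : ∀ {x z} → Directed v (b ∷ y ∷ zs) u x z ⊎ Directed v (b ∷ y ∷ zs) u z x →
                  ¬ S x → S z → z ≡ p ⊎ z ≡ v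
      crossings (inj₁ (inj₂ (_ , z≡v))) ¬Sx Sz = inj₂ z≡v
      crossings (inj₂ (inj₂ (refl , _))) ¬Sx Sz = contradiction Sz (last-in ρ)
      crossings (inj₁ (inj₁ c)) ¬Sx Sz with split c
      ... | inj₁ refl               = contradiction (last-in π) ¬Sx
      ... | inj₂ (inj₁ (Sx , _))    = contradiction Sx ¬Sx
      ... | inj₂ (inj₂ (_ , ¬Sz))   = contradiction Sz ¬Sz
      crossings (inj₂ (inj₁ c)) ¬Sx Sz with split c
      ... | inj₁ z≡p                = inj₁ z≡p
      ... | inj₂ (inj₁ (_ , Sx))    = contradiction Sx ¬Sx
      ... | inj₂ (inj₂ (¬Sz , _))   = contradiction Sz ¬Sz
    close : ∀ bs → SimplePath (λ x → S x ⊎ ¬ S x) v (b ∷ bs ++ p′ ∷ cs) u →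
            Consec (v ∷ b ∷ bs ++ p′ ∷ cs) p p′ →
            (∀ {x z} → Consec (v ∷ b ∷ bs ++ p′ ∷ cs) x z → x ≡ p ⊎ (S x × S z) ⊎ (¬ S x × ¬ S z)) →
            CrossingCycle S p p′ v u
    -- The split only exposes the entry after `b`, which is `p′` or the head of `bs`, as `closePath`
    -- requires.
    close []       = closeWith
    close (_ ∷ _)  = closeWith

-- Balls and distances around the fire source.

module BFS (G : Graph n) (r : Fin n) where

  -- Balls are the states of a fire that nobody fights, so facts about runs apply to them, and every
  -- fire stays inside them (`burning⊆ball`).
  ball : ℕ → Subset n
  ball t = burning (run G r (λ _ → ⊥) t)

  r∈ball : ∀ t → r ∈ ball t
  r∈ball zero    = x∈⁅x⁆ r
  r∈ball (suc t) = burning-suc G r _ t (r∈ball t)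

  none-protected : ∀ t {v} → v ∉ protected (run G r (λ _ → ⊥) t)
  none-protected t i = ∉⊥ (proj₂ (proj₂ (protected⁻ G r _ t i)))

  ball-step : ∀ t {u v} → u ∈ ball t → Adj G u v → v ∈ ball (suc t)
  ball-step t = burning-spread G r _ t (none-protected (suc t))

  ball-step⁻ : ∀ t {v} → v ∈ ball (suc t) → v ∈ ball t ⊎ ∃ λ u → u ∈ ball t × Adj G u v
  ball-step⁻ t i with ∈-burning-suc⁻ G r _ t i
  ... | inj₁ j = inj₁ j
  ... | inj₂ (_ , e) = inj₂ e

  ball-mono : ∀ {s t} → s ≤ t → ball s ⊆ ball t
  ball-mono s≤t = burning-mono G r _ s≤t

  -- The component of `r`, in decidable form; radius `n` suffices by `grows-or-stable`.
  Reach : Fin n → Set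
  Reach v = v ∈ ball n

  stable-suc : ∀ t → ball (suc t) ⊆ ball t → ball (2 + t) ⊆ ball (suc t)
  stable-suc t stable i with ball-step⁻ (suc t) i
  ... | inj₁ j            = j
  ... | inj₂ (u , j , uv) = ball-step t (stable j) uv

  -- Since a ball has at most n vertices, it is stable from radius n on.
  grows-or-stable : ∀ t → t < ∣ ball t ∣ ⊎ (ball (suc t) ⊆ ball t)
  grows-or-stable zero = inj₁ (≤-reflexive (sym (∣⁅x⁆∣≡1 r)))
  grows-or-stable (suc t) with grows-or-stable t
  ... | inj₂ stable = inj₂ (stable-suc t stable)
  ... | inj₁ t< with Fin.any? (λ v → (v ∈? ball (suc t)) ×-dec ¬? (v ∈? ball t))
  ...   | yes (v , i , ∉t) = inj₁ (≤-trans (s≤s t<) (p⊂q⇒∣p∣<∣q∣ (burning-suc G r _ t , v , i , ∉t)))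
  ...   | no none = inj₂ (stable-suc t stable)
    where
    stable : ball (suc t) ⊆ ball t
    stable {v} i = decidable-stable (v ∈? ball t) λ ∉t → none (v , i , ∉t)

  Reach-step : ∀ {u v} → Reach u → Adj G u v → Reach v
  Reach-step i uv with grows-or-stable n
  ... | inj₁ n<    = contradiction (<-≤-trans n< (∣p∣≤n (ball n))) (<-irrefl refl)
  ... | inj₂ stable = stable (ball-step n i uv)

  ball⊆Reach : ∀ t {v} → v ∈ ball t → Reach v
  ball⊆Reach zero i = ball-mono {0} {n} z≤n i
  ball⊆Reach (suc t) i with ball-step⁻ t i
  ... | inj₁ j = ball⊆Reach t j
  ... | inj₂ (u , j , uv) = Reach-step (ball⊆Reach t j) uv

  burning⊆ball : ∀ σ t → burning (run G r σ t) ⊆ ball t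
  burning⊆ball σ zero    i = i
  burning⊆ball σ (suc t) i with ∈-burning-suc⁻ G r σ t i
  ... | inj₁ j = burning-suc G r _ t (burning⊆ball σ t j)
  ... | inj₂ (_ , u , j , uv) = ball-step t (burning⊆ball σ t j) uv

  level : ℕ → Fin n → ℕ
  level zero    v = 0
  level (suc t) v with v ∈? ball t
  ... | yes _ = level t v
  ... | no  _ = suc t

  level-∈ : ∀ t {v} → v ∈ ball t → v ∈ ball (level t v)
  level-∈ zero i = i
  level-∈ (suc t) {v} i with v ∈? ball t
  ... | yes j = level-∈ t j
  ... | no  _ = i

  level-least : ∀ t {v} s → v ∈ ball s → level t v ≤ s
  level-least zero s i = z≤n
  level-least (suc t) {v} s i with v ∈? ball t
  ... | yes _ = level-least t s i
  ... | no ∉t = ≰⇒> λ s≤t → ∉t (ball-mono s≤t i)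

  -- Takes the junk value n outside the component of r.
  dist : Fin n → ℕ
  dist = level n

  ∈-ball-dist : ∀ {v} → Reach v → v ∈ ball (dist v)
  ∈-ball-dist = level-∈ n

  dist≤ : ∀ t {v} → v ∈ ball t → dist v ≤ t
  dist≤ t = level-least n t

  -- The breadth-first tree and its subtrees.

  IsParent : Fin n → Fin n → Set
  IsParent v u = Reach u × Adj G u v × suc (dist u) ≡ dist v

  isParent? : ∀ v → Decidable (IsParent v)
  isParent? v u = (u ∈? ball n) ×-dec ((adj G u v Bool.≟ true) ×-dec (suc (dist u) Data.Nat.≟ dist v))

  ∃-parent : ∀ {v} → Reach v → v ≢ r → ∃ (IsParent v)
  ∃-parent {v} Rv v≢r with dist v in e | ∈-ball-dist Rv
  ... | zero  | i = contradiction (x∈⁅y⁆⇒x≡y r i) v≢r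
  ... | suc k | i with ball-step⁻ k i
  ...   | inj₁ j = contradiction (≤-trans (≤-reflexive (sym e)) (dist≤ k j)) (<-irrefl refl)
  ...   | inj₂ (u , j , uv) = u , ball⊆Reach k j , uv ,
          -- `u` lies in the ball of radius `k`; were it nearer to `r` than `k`, its neighbour `v`
          -- would be nearer than `suc k`.
          ≤-antisym (s≤s (dist≤ k j))
            (≤-trans (≤-reflexive (sym e)) (dist≤ (suc (dist u)) (ball-step (dist u) (∈-ball-dist (ball⊆Reach k j)) uv)))

  parent : Fin n → Fin n
  parent v with Fin.any? (isParent? v)
  ... | yes (u , _) = u
  -- This default is taken at `r` and outside the component of `r`.
  ... | no  _       = v

  parent-isParent : ∀ {v} → Reach v → v ≢ r → IsParent v (parent v)
  parent-isParent {v} Rv v≢r with Fin.any? (isParent? v)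
  ... | yes (_ , p) = p
  ... | no none     = contradiction (∃-parent Rv v≢r) none

  dist-r : dist r ≡ 0
  dist-r = n≤0⇒n≡0 (dist≤ 0 (r∈ball 0))

  dist-zero : ∀ {v} → Reach v → dist v ≡ 0 → v ≡ r
  dist-zero {v} Rv e = x∈⁅y⁆⇒x≡y r (subst (λ t → v ∈ ball t) e (∈-ball-dist Rv))

  -- The fuel `k` bounds the climb towards the root and makes the relation decidable by recursion.
  -- `Below` supplies `dist v`, which just suffices to reach `r`.
  Anc : ℕ → Fin n → Fin n → Set
  Anc zero    p v = v ≡ p
  Anc (suc k) p v = v ≡ p ⊎ Anc k p (parent v)

  anc? : ∀ k p → Decidable (Anc k p)
  anc? zero    p v = v ≟ p
  anc? (suc k) p v = (v ≟ p) ⊎-dec anc? k p (parent v)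

  Below : Fin n → Fin n → Set
  Below p v = Reach v × Anc (dist v) p v

  below? : ∀ p → Decidable (Below p)
  below? p v = (v ∈? ball n) ×-dec anc? (dist v) p v

  Below-refl : ∀ {p} → Reach p → Below p p
  Below-refl {p} Rp = Rp , go (dist p)
    where
    go : ∀ k → Anc k p p
    go zero    = refl
    go (suc k) = inj₁ refl

  Below-up : ∀ {p v} → Reach v → v ≢ r → Below p (parent v) → Below p v
  Below-up {p} {v} Rv v≢r (_ , a) with parent-isParent Rv v≢r
  ... | _ , _ , e = Rv , subst (λ k → Anc k p v) e (inj₂ a)

  Below-down : ∀ {p v} → Below p v → v ≡ p ⊎ (v ≢ r × Below p (parent v))
  Below-down {p} {v} (Rv , a) with v ≟ p | v ≟ r
  ... | yes v≡p | _ = inj₁ v≡p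
  ... | no _ | yes refl = inj₁ (subst (λ k → Anc k p v) dist-r a)
  ... | no v≢p | no v≢r with parent-isParent Rv v≢r
  ...   | Ru , _ , e with subst (λ k → Anc k p v) (sym e) a
  ...     | inj₁ v≡p = contradiction v≡p v≢p
  ...     | inj₂ b   = inj₂ (v≢r , Ru , b)

  -- Parents are strictly closer to `r`, so induction on `dist` descends the tree from the root.
  parent-rec : (P : Fin n → Set) → P r → (∀ {v} → Reach v → v ≢ r → P (parent v) → P v) →
               ∀ {v} → Reach v → P v
  parent-rec P Pr Pstep {v} Rv = go (dist v) Rv refl
    where
    go : ∀ k {v} → Reach v → dist v ≡ k → P v
    go zero    Rv e = subst P (sym (dist-zero Rv e)) Pr
    go (suc k) {v} Rv e with v ≟ r
    ... | yes refl = Pr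
    ... | no v≢r with parent-isParent Rv v≢r
    ...   | Ru , _ , e′ = Pstep Rv v≢r (go k Ru (suc-injective (trans e′ e)))

  Below-dist : ∀ {p v} → Below p v → dist p ≤ dist v
  Below-dist {p} {v} b = parent-rec (λ v → Below p v → dist p ≤ dist v) at-r at-child (proj₁ b) b
    where
    at-r : Below p r → dist p ≤ dist r
    at-r b with Below-down b
    ... | inj₁ refl = ≤-refl
    ... | inj₂ (r≢r , _) = contradiction refl r≢r
    at-child : ∀ {v} → Reach v → v ≢ r → (Below p (parent v) → dist p ≤ dist (parent v)) → Below p v → dist p ≤ dist v
    at-child Rv v≢r ih b with Below-down b
    ... | inj₁ refl = ≤-refl
    ... | inj₂ (_ , b′) with parent-isParent Rv v≢r
    ...   | _ , _ , e = ≤-trans (ih b′) (≤-trans (n≤1+n _) (≤-reflexive e))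

  Adj-sym : ∀ {u v} → Adj G u v → Adj G v u
  Adj-sym {u} {v} e = trans (adj-sym G v u) e

  connected-in : ∀ {p v} → Below p v → Connected G (Below p) v p
  connected-in {p} b = parent-rec (λ v → Below p v → Connected G (Below p) v p) (λ b → go b (λ r≢r → contradiction refl r≢r))
      (λ Rv v≢r ih b → go b (λ _ b′ → connected-step G b (Adj-sym (proj₁ (proj₂ (parent-isParent Rv v≢r)))) (ih b′)))
      (proj₁ b) b
    where
    go : ∀ {v} → Below p v → (v ≢ r → Below p (parent v) → Connected G (Below p) v p) → Connected G (Below p) v p
    go b rec with Below-down b
    ... | inj₁ refl       = _ , end b
    ... | inj₂ (v≢r , b′) = rec v≢r b′

  -- By `Below-up`, the climb from `u` to `r` avoids the subtree. Paths grow only at their start,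
  -- hence the induction turns any path from `x` to `w` into one from `r` to `w`.
  connected-from-r : ∀ {p u} → Reach u → ¬ Below p u → Connected G (λ x → ¬ Below p x) r u
  connected-from-r {p} Ru ¬b = parent-rec
    (λ x → ¬ Below p x → ∀ {w} → Connected G (λ x → ¬ Below p x) x w → Connected G (λ x → ¬ Below p x) r w)
    (λ _ π → π)
    (λ Rx x≢r ih ¬b π → let ¬b′ = ¬b ∘ Below-up Rx x≢r in
       ih ¬b′ (connected-step G ¬b′ (proj₁ (proj₂ (parent-isParent Rx x≢r))) π))
    Ru ¬b (_ , end ¬b)

  connected-out : ∀ {p x u} → Reach x → ¬ Below p x → Reach u → ¬ Below p u → Connected G (λ x → ¬ Below p x) x u
  connected-out {p} {u = u} Rx ¬bx Ru ¬bu = parent-rec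
    (λ x → ¬ Below p x → Connected G (λ x → ¬ Below p x) x u)
    (λ _ → connected-from-r Ru ¬bu)
    (λ Rx x≢r ih ¬b → connected-step G ¬b (Adj-sym (proj₁ (proj₂ (parent-isParent Rx x≢r)))) (ih (¬b ∘ Below-up Rx x≢r)))
    Rx ¬bx

  parent-not-below : ∀ {p} → Reach p → p ≢ r → ¬ Below p (parent p)
  parent-not-below Rp p≢r b with parent-isParent Rp p≢r
  ... | _ , _ , e = <-irrefl refl (≤-trans (≤-reflexive e) (Below-dist b))

  -- Boundaries of subtrees in a cactus.

  OnBoundary : Subset n → Fin n → Set
  OnBoundary X v = v ∈ X × ∃ λ u → u ∉ X × Adj G u v

  onBoundary? : ∀ X → Decidable (OnBoundary X)
  onBoundary? X v = (v ∈? X) ×-dec Fin.any? (λ u → ¬? (u ∈? X) ×-dec (adj G u v Bool.≟ true))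

  boundary : Subset n → Subset n
  boundary X = subset (onBoundary? X)

  Target : ℕ → Fin n → Fin n → Set
  Target t p v = Below p v × t < dist p

  target? : ∀ t p → Decidable (Target t p)
  target? t p v = below? p v ×-dec (t <? dist p)

  -- Empty unless p lies outside the ball of radius t, which contains the fire when
  -- round t + 1 begins.
  target : ℕ → Fin n → Subset n
  target t p = subset (target? t p)

  module _ (cactus : Cactus G) where

    -- Both crossing cycles contain the edge from `p` to its parent, so in a cactus they have the
    -- same edges. The second one then contains the edge from `u` to `v`, but it enters the subtree
    -- only at `p` and `v′`.
    same-exit : ∀ {p v v′ u u′} → Reach p → p ≢ r → v ≢ p → v′ ≢ p →
                Below p v → ¬ Below p u → Adj G u v → Below p v′ → ¬ Below p u′ → Adj G u′ v′ → v ≡ v′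
    same-exit {p} {v} {v′} {u} {u′} Rp p≢r v≢p v′≢p bv ¬bu uv bv′ ¬bu′ u′v′ =
      [ (λ v≡p → contradiction v≡p v≢p) , (λ e → e) ]′ (C′.crossings uv∈C′ ¬bu bv)
      where
      parent-p = parent-isParent Rp p≢r
      crossing : ∀ {v u} → v ≢ p → Below p v → ¬ Below p u → Adj G u v →
                 CrossingCycle G (Below p) p (parent p) v u
      crossing v≢p bv ¬bu uv = crossingCycle G v≢p (connected-in bv) (Adj-sym (proj₁ (proj₂ parent-p)))
        (connected-out (proj₁ parent-p) (parent-not-below Rp p≢r) (Reach-step (proj₁ bv) (Adj-sym uv)) ¬bu) uv
      module C  = CrossingCycle (crossing v≢p bv ¬bu uv)
      module C′ = CrossingCycle (crossing v′≢p bv′ ¬bu′ u′v′)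
      uv∈C′ : EdgeOf C′.cycle u v
      uv∈C′ = Equivalence.to (cactus C.cycle C′.cycle p (parent p) (Adj-sym (proj₁ (proj₂ parent-p))) C.edge-p C′.edge-p u v) C.edge-v

    -- If some boundary vertex `q` differs from `p`, every other such vertex equals `q` by
    -- `same-exit`. The root is excluded, because a nonempty target has `t < dist p`.
    ∣boundary∣≤2 : ∀ t p → ∣ boundary (target t p) ∣ ≤ 2
    ∣boundary∣≤2 t p with Fin.any? (λ q → onBoundary? (target t p) q ×-dec ¬? (q ≟ p))
    ... | no none = ≤-trans (p⊆q⇒∣p∣≤∣q∣ ⊆p) (≤-trans (≤-reflexive (∣⁅x⁆∣≡1 p)) (n≤1+n 1))
      where
      ⊆p : boundary (target t p) ⊆ ⁅ p ⁆
      ⊆p {v} i with v ≟ p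
      ... | yes refl = x∈⁅x⁆ p
      ... | no v≢p   = contradiction (v , ∈-subset⁻ (onBoundary? _) i , v≢p) none
    ... | yes (q , (q∈ , u , u∉ , uq) , q≢p) =
        ≤-trans (p⊆q⇒∣p∣≤∣q∣ ⊆pq) (≤-trans (∣∪∣≤ ⁅ p ⁆ ⁅ q ⁆) (≤-reflexive (cong₂ _+_ (∣⁅x⁆∣≡1 p) (∣⁅x⁆∣≡1 q))))
      where
      t<p : t < dist p
      t<p = proj₂ (∈-subset⁻ (target? t p) q∈)
      p≢r : p ≢ r
      p≢r refl with subst (t <_) dist-r t<p
      ... | ()
      outside-below : ∀ {u} → u ∉ target t p → ¬ Below p u
      outside-below u∉ b = u∉ (∈-subset⁺ (target? t p) (b , t<p))
      Rp : Reach p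
      Rp = proj₁ (last-in G (proj₂ (connected-in (proj₁ (∈-subset⁻ (target? t p) q∈)))))
      ⊆pq : boundary (target t p) ⊆ ⁅ p ⁆ ∪ ⁅ q ⁆
      ⊆pq {v} i with v ≟ p | ∈-subset⁻ (onBoundary? (target t p)) i
      ... | yes refl | _ = x∈p∪q⁺ (inj₁ (x∈⁅x⁆ p))
      ... | no v≢p | v∈ , w , w∉ , wv = x∈p∪q⁺ (inj₂ (subst (_∈ ⁅ q ⁆)
              (same-exit Rp p≢r q≢p v≢p (below q∈) (outside-below u∉) uq (below v∈) (outside-below w∉) wv) (x∈⁅x⁆ q)))
        where
        below : ∀ {v} → v ∈ target t p → Below p v
        below i = proj₁ (∈-subset⁻ (target? t p) i)

  -- The greedy algorithm.

  abstract
    -- Kept opaque: later arguments use only the maximality of the choice.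
    best : ℕ → Subset n → Fin n
    best t W = argmax (λ p → ∣ target t p ─ W ∣) r (allFin n)

    best-maximal : ∀ t W p → ∣ target t p ─ W ∣ ≤ ∣ target t (best t W) ─ W ∣
    best-maximal t W p = All.lookup (f[xs]≤f[argmax] {f = λ p → ∣ target t p ─ W ∣} r (allFin n)) (∈-allFin p)

  greedy : ℕ → ℕ → Subset n → Subset n
  greedy t zero    W = W
  greedy t (suc k) W = greedy t k (W ∪ target t (best t W))

  guards : ℕ → ℕ → Subset n → Subset n
  guards t zero    W = ⊥
  guards t (suc k) W = boundary (target t (best t W)) ∪ guards t k (W ∪ target t (best t W))

  ⊆greedy : ∀ t k {W} → W ⊆ greedy t k W
  ⊆greedy t zero    i = i
  ⊆greedy t (suc k) i = ⊆greedy t k (x∈p∪q⁺ (inj₁ i))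

  -- Each of the `k` choices is best relative to a set contained in `V`, so it gains at least the
  -- part of any target outside `V`. With `V` the set claimed in the end, one bound serves the whole
  -- round.
  greedy-gain : ∀ t k {W V} → greedy t k W ⊆ V → ∀ p →
                ∣ W ∣ + k * ∣ target t p ─ V ∣ ≤ ∣ greedy t k W ∣
  greedy-gain t zero {W} _ p = ≤-reflexive (+-identityʳ ∣ W ∣)
  greedy-gain t (suc k) {W} {V} ⊆V p = begin
    ∣ W ∣ + (x + k * x)                          ≡⟨ sym (+-assoc ∣ W ∣ x (k * x)) ⟩
    ∣ W ∣ + x + k * x                            ≤⟨ +-monoˡ-≤ (k * x) (+-monoʳ-≤ ∣ W ∣ x≤) ⟩
    ∣ W ∣ + ∣ target t (best t W) ─ W ∣ + k * x  ≤⟨ +-monoˡ-≤ (k * x) (∣p∣+∣q─p∣≤∣p∪q∣ W _) ⟩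
    ∣ W ∪ target t (best t W) ∣ + k * x          ≤⟨ greedy-gain t k ⊆V p ⟩
    ∣ greedy t (suc k) W ∣                       ∎
    where
    open ≤-Reasoning
    x = ∣ target t p ─ V ∣
    x≤ : x ≤ ∣ target t (best t W) ─ W ∣
    x≤ = ≤-trans (p⊆q⇒∣p∣≤∣q∣ (─-mono {p = target t p} (λ i → i) (λ i → ⊆V (⊆greedy t (suc k) i)))) (best-maximal t W p)

  ∈-greedy⁻ : ∀ t k {W v} → v ∈ greedy t k W →
              v ∈ W ⊎ ∃ λ p → v ∈ target t p × boundary (target t p) ⊆ guards t k W
  ∈-greedy⁻ t zero i = inj₁ i
  ∈-greedy⁻ t (suc k) {W} i with ∈-greedy⁻ t k {W ∪ target t (best t W)} i
  ... | inj₂ (p , j , ⊆g) = inj₂ (p , j , λ b → x∈p∪q⁺ (inj₂ (⊆g b)))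
  ... | inj₁ j with x∈p∪q⁻ W (target t (best t W)) j
  ...   | inj₁ w = inj₁ w
  ...   | inj₂ x = inj₂ (best t W , x , λ b → x∈p∪q⁺ (inj₁ b))

  ∣guards∣≤ : Cactus G → ∀ t k W → ∣ guards t k W ∣ ≤ k * 2
  ∣guards∣≤ cactus t zero    W = ≤-reflexive (∣⊥∣≡0 n)
  ∣guards∣≤ cactus t (suc k) W = ≤-trans (∣∪∣≤ (boundary (target t (best t W))) _)
    (+-mono-≤ (∣boundary∣≤2 cactus t (best t W)) (∣guards∣≤ cactus t k _))

  -- For legality: when round `t + 1` begins, the fire lies in the ball of radius `t`, so no guard
  -- is burning.
  guards-far : ∀ t k W {v} → v ∈ guards t k W → t < dist v
  guards-far t zero W i = contradiction i ∉⊥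
  guards-far t (suc k) W i with x∈p∪q⁻ (boundary (target t (best t W))) (guards t k (W ∪ target t (best t W))) i
  ... | inj₂ j = guards-far t k (W ∪ target t (best t W)) j
  ... | inj₁ j with ∈-subset⁻ (target? t (best t W)) (proj₁ (∈-subset⁻ (onBoundary? (target t (best t W))) j))
  ...   | b , t<p = <-≤-trans t<p (Below-dist b)

  -- The history is listed with the current round first.
  claimed : List ℕ → Subset n
  claimed []         = ⊥
  claimed (x ∷ past) = greedy (length past) (x / 2) (claimed past)

  newGuards : ℕ → List ℕ → Subset n
  newGuards x past = guards (length past) (x / 2) (claimed past)

  guarded : List ℕ → Subset n
  guarded []         = ⊥
  guarded (x ∷ past) = guarded past ∪ newGuards x past

  -- Guards of earlier rounds are dropped, because a vertex may be protected only once.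
  move : List ℕ → Subset n
  move []         = ⊥
  move (x ∷ past) = newGuards x past ─ guarded past

  -- Unless a tree ancestor of v is protected in time, the fire descends the tree path to v on schedule.
  burns-or-covered : ∀ σ {v} → Reach v →
                     v ∈ burning (run G r σ (dist v)) ⊎ ∃ λ t → ∃ λ p → p ∈ σ t × v ∈ target t p
  burns-or-covered σ = parent-rec
    (λ v → v ∈ burning (run G r σ (dist v)) ⊎ ∃ λ t → ∃ λ p → p ∈ σ t × v ∈ target t p)
    (inj₁ (burning-mono G r σ {0} {dist r} z≤n (x∈⁅x⁆ r))) child
    where
    child : ∀ {v} → Reach v → v ≢ r →
            parent v ∈ burning (run G r σ (dist (parent v))) ⊎ (∃ λ t → ∃ λ p → p ∈ σ t × parent v ∈ target t p) →
            v ∈ burning (run G r σ (dist v)) ⊎ ∃ λ t → ∃ λ p → p ∈ σ t × v ∈ target t p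
    child Rv v≢r (inj₂ (t , p , p∈ , j)) with ∈-subset⁻ (target? t p) j
    ... | b , t<p = inj₂ (t , p , p∈ , ∈-subset⁺ (target? t p) (Below-up Rv v≢r b , t<p))
    child {v} Rv v≢r (inj₁ u∈) with parent-isParent Rv v≢r
    ... | _ , uv , e with v ∈? protected (run G r σ (suc (dist (parent v))))
    ...   | no ∉P = inj₁ (subst (λ t → v ∈ burning (run G r σ t)) e (burning-spread G r σ _ ∉P u∈ uv))
    ...   | yes ∈P with protected⁻ G r σ _ ∈P
    ...     | s , s< , v∈ = inj₂ (s , v , v∈ , ∈-subset⁺ (target? s v) (Below-refl Rv , subst (s <_) e s<))

  -- What is charged to the first `t` rounds of `σ`. `V` is the same in all rounds, as only vertices
  -- that the algorithm never claims need charging.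
  covered : Strategy n → Subset n → ℕ → Subset n
  covered σ V zero    = ⊥
  covered σ V (suc t) = covered σ V t ∪ ⋃ (σ t) (λ p → target t p ─ V)

  ∈-covered : ∀ σ V {m t p v} → t < m → p ∈ σ t → v ∈ target t p → v ∉ V → v ∈ covered σ V m
  ∈-covered σ V {suc m} {t} t<m i j ∉V with m≤n⇒m<n∨m≡n (s≤s⁻¹ t<m)
  ... | inj₁ t<m′ = x∈p∪q⁺ (inj₁ (∈-covered σ V t<m′ i j ∉V))
  ... | inj₂ refl = x∈p∪q⁺ (inj₂ (∈-⋃⁺ i (x∈p∧x∉q⇒x∈p─q j ∉V)))

-- `play` lists the oldest round first, `move` expects the current one first.
algorithm : OnlineAlg
algorithm G r fs = BFS.move G r (reverse fs)

-- The run of the algorithm.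

module Analysis (G : Graph n) (r : Fin n) (f : ℕ → ℕ) where
  open BFS G r

  past : ℕ → List ℕ
  past = applyDownFrom f

  σ : Strategy n
  σ = play algorithm G r f

  guardsAt : ℕ → Subset n
  guardsAt t = guards t (f t / 2) (claimed (past t))

  newGuards≡ : ∀ t → newGuards (f t) (past t) ≡ guardsAt t
  newGuards≡ t = cong (λ l → guards l (f t / 2) (claimed (past t))) (List.length-applyDownFrom f t)

  σ≡ : ∀ t → σ t ≡ guardsAt t ─ guarded (past t)
  σ≡ t = trans (cong move (List.reverse-applyUpTo f (suc t))) (cong (_─ guarded (past t)) (newGuards≡ t))

  claimed-suc : ∀ t → claimed (past (suc t)) ≡ greedy t (f t / 2) (claimed (past t))
  claimed-suc t = cong (λ l → greedy l (f t / 2) (claimed (past t))) (List.length-applyDownFrom f t)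

  guarded-suc : ∀ t → guarded (past (suc t)) ≡ guarded (past t) ∪ guardsAt t
  guarded-suc t = cong (guarded (past t) ∪_) (newGuards≡ t)

  -- With the converse below, the set computed from the history alone is the one protected in the
  -- game.
  protected⊆guarded : ∀ t → protected (run G r σ t) ⊆ guarded (past t)
  protected⊆guarded zero i = i
  protected⊆guarded (suc t) {v} i = subst (v ∈_) (sym (guarded-suc t)) (x∈p∪q⁺
    ([ inj₁ ∘ protected⊆guarded t
     , (λ j → inj₂ (p─q⊆p (guardsAt t) (guarded (past t)) (subst (v ∈_) (σ≡ t) j))) ]′
     (x∈p∪q⁻ (protected (run G r σ t)) (σ t) i)))

  guarded⊆protected : ∀ t → guarded (past t) ⊆ protected (run G r σ t)
  guarded⊆protected zero i = i
  guarded⊆protected (suc t) {v} i with v ∈? guarded (past t)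
  ... | yes j = x∈p∪q⁺ (inj₁ (guarded⊆protected t j))
  ... | no ∉g with x∈p∪q⁻ (guarded (past t)) (guardsAt t) (subst (v ∈_) (guarded-suc t) i)
  ...   | inj₁ j = contradiction j ∉g
  ...   | inj₂ j = x∈p∪q⁺ (inj₂ (subst (v ∈_) (sym (σ≡ t)) (x∈p∧x∉q⇒x∈p─q j ∉g)))

  guarded-mono : ∀ {s t} → s ≤ t → guarded (past s) ⊆ guarded (past t)
  guarded-mono {t = zero} z≤n i = i
  guarded-mono {t = suc t} s≤ i with m≤n⇒m<n∨m≡n s≤
  ... | inj₁ s<  = x∈p∪q⁺ (inj₁ (guarded-mono (s≤s⁻¹ s<) i))
  ... | inj₂ refl = i

  claimed-mono : ∀ {s t} → s ≤ t → claimed (past s) ⊆ claimed (past t)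
  claimed-mono {t = zero} z≤n i = i
  claimed-mono {t = suc t} s≤ i with m≤n⇒m<n∨m≡n s≤
  ... | inj₁ s<  = ⊆greedy (length (past t)) (f t / 2) (claimed-mono (s≤s⁻¹ s<) i)
  ... | inj₂ refl = i

  legal : Cactus G → Legal G r f σ
  legal cactus t = size , fresh
    where
    size : ∣ σ t ∣ ≤ f t
    size = begin
      ∣ σ t ∣                            ≡⟨ cong ∣_∣ (σ≡ t) ⟩
      ∣ guardsAt t ─ guarded (past t) ∣  ≤⟨ ∣p─q∣≤∣p∣ (guardsAt t) _ ⟩
      ∣ guardsAt t ∣                     ≤⟨ ∣guards∣≤ cactus t (f t / 2) _ ⟩
      f t / 2 * 2                        ≤⟨ m/n*n≤m (f t) 2 ⟩
      f t                                ∎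
      where open ≤-Reasoning
    fresh : ∀ v → v ∈ σ t → v ∉ burning (run G r σ t) × v ∉ protected (run G r σ t)
    fresh v i with subst (v ∈_) (σ≡ t) i
    ... | j = (λ b → <-irrefl refl (<-≤-trans (guards-far t (f t / 2) _ (p─q⊆p _ (guarded (past t)) j)) (dist≤ t (burning⊆ball σ t b))))
            , (λ p → ∉-─ (guardsAt t) (guarded (past t)) j (protected⊆guarded t p))

  -- For `t ≤ s` the fire is still within distance `s` and the target lies beyond. Afterwards the
  -- fire would have to enter through the boundary, which is protected from round `s + 1` on.
  target-unburnt : ∀ t {s p v} → boundary (target s p) ⊆ guarded (past (suc s)) →
                   v ∈ target s p → v ∉ burning (run G r σ t)
  target-unburnt t {s} {p} {v} ⊆g i b with t ≤? s | ∈-subset⁻ (target? s p) i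
  ... | yes t≤s | below , s<p = <-irrefl refl
        (≤-trans (≤-trans s<p (Below-dist below)) (≤-trans (dist≤ t (burning⊆ball σ t b)) t≤s))
  target-unburnt zero ⊆g i b | no t≰s | _ = t≰s z≤n
  target-unburnt (suc t) {s} {p} {v} ⊆g i b | no t≰s | _ with ∈-burning-suc⁻ G r σ t b
  ... | inj₁ b′ = target-unburnt t ⊆g i b′
  -- The burning neighbour `u` is outside the target by induction, so `v` is on the boundary.
  ... | inj₂ (∉P , u , b′ , uv) = ∉P (guarded⊆protected (suc t) (guarded-mono (≰⇒> t≰s)
          (⊆g (∈-subset⁺ (onBoundary? (target s p)) (i , u , (λ j → target-unburnt t ⊆g j b′) , uv)))))

  claimed⁻ : ∀ m {v} → v ∈ claimed (past m) →
             ∃ λ s → ∃ λ p → v ∈ target s p × boundary (target s p) ⊆ guarded (past (suc s))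
  claimed⁻ zero i = contradiction i ∉⊥
  claimed⁻ (suc m) {v} i with ∈-greedy⁻ m (f m / 2) (subst (v ∈_) (claimed-suc m) i)
  ... | inj₁ j = claimed⁻ m j
  ... | inj₂ (p , j , ⊆g) = m , p , j , λ {x} b → subst (x ∈_) (sym (guarded-suc m)) (x∈p∪q⁺ (inj₂ (⊆g b)))

  claimed-unburnt : ∀ m t → claimed (past m) ⊆ ∁ (burning (run G r σ t))
  claimed-unburnt m t i with claimed⁻ m i
  ... | s , p , j , ⊆g = x∉p⇒x∈∁p (target-unburnt t ⊆g j)

  -- Comparison with an offline strategy.

  module _ (even : ∀ i → 2 ∣ f i) {τ : Strategy n} (τ-legal : Legal G r f τ) where

    -- In round `m + 1`, `greedy-gain` bounds `f m / 2` times each single charge by the gain of the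
    -- algorithm, and `τ` has at most twice `f m / 2` firefighters. The gains telescope to the size
    -- of the claimed set.
    ∣covered∣≤ : ∀ V m → claimed (past m) ⊆ V → ∣ covered τ V m ∣ ≤ 2 * ∣ claimed (past m) ∣
    ∣covered∣≤ V zero _ = ≤-trans (≤-reflexive (∣⊥∣≡0 n)) z≤n
    ∣covered∣≤ V (suc m) ⊆V = begin
      ∣ covered τ V m ∪ ⋃ (τ m) X ∣          ≤⟨ ∣∪∣≤ (covered τ V m) _ ⟩
      ∣ covered τ V m ∣ + ∣ ⋃ (τ m) X ∣      ≤⟨ +-mono-≤ (∣covered∣≤ V m (λ i → ⊆V (claimed-mono (n≤1+n m) i)))
                                                        (∣⋃∣≤2*D (f m / 2) (τ m) X τ≤ gain) ⟩
      2 * ∣ W ∣ + 2 * (∣ W⁺ ∣ ∸ ∣ W ∣)       ≡⟨ sym (*-distribˡ-+ 2 ∣ W ∣ _) ⟩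
      2 * (∣ W ∣ + (∣ W⁺ ∣ ∸ ∣ W ∣))         ≡⟨ cong (2 *_) (m+[n∸m]≡n (p⊆q⇒∣p∣≤∣q∣ (claimed-mono (n≤1+n m)))) ⟩
      2 * ∣ W⁺ ∣                             ∎
      where
      open ≤-Reasoning
      W W⁺ : Subset n
      W  = claimed (past m)
      W⁺ = claimed (past (suc m))
      X : Fin n → Subset n
      X p = target m p ─ V
      τ≤ : ∣ τ m ∣ ≤ f m / 2 * 2
      -- Evenness makes the halving in `f m / 2` exact.
      τ≤ = ≤-trans (proj₁ (τ-legal m)) (≤-reflexive (sym (m/n*n≡m (even m))))
      gain : ∀ p → f m / 2 * ∣ X p ∣ ≤ ∣ W⁺ ∣ ∸ ∣ W ∣
      gain p = m+n≤o⇒m≤o∸n _ (begin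
        f m / 2 * ∣ X p ∣ + ∣ W ∣                   ≡⟨ +-comm (f m / 2 * ∣ X p ∣) ∣ W ∣ ⟩
        ∣ W ∣ + f m / 2 * ∣ X p ∣                   ≤⟨ greedy-gain m (f m / 2) (subst (_⊆ V) (claimed-suc m) ⊆V) p ⟩
        ∣ greedy m (f m / 2) W ∣                    ≡⟨ cong ∣_∣ (sym (claimed-suc m)) ⟩
        ∣ W⁺ ∣                                      ∎)

    competitive : SavedLe (unburnt G r τ) 3 (unburnt G r σ)
    -- Time `n` suffices for every `t`: `dist` is at most `n` on the component, so the fire has had
    -- time for every tree path.
    competitive t = n , (begin
      ∣ ∁ (burning (run G r τ n)) ∣        ≤⟨ p⊆q⇒∣p∣≤∣q∣ saved⊆ ⟩
      ∣ U ∪ covered τ V n ∣                ≤⟨ ∣∪∣≤ U _ ⟩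
      ∣ U ∣ + ∣ covered τ V n ∣            ≤⟨ +-monoʳ-≤ ∣ U ∣ (∣covered∣≤ V n (λ i → i)) ⟩
      ∣ U ∣ + 2 * ∣ V ∣                    ≤⟨ +-monoʳ-≤ ∣ U ∣ (*-monoʳ-≤ 2 (p⊆q⇒∣p∣≤∣q∣ (claimed-unburnt n t))) ⟩
      3 * ∣ U ∣                            ∎)
      where
      open ≤-Reasoning
      U V : Subset n
      U = ∁ (burning (run G r σ t))
      V = claimed (past n)
      saved⊆ : ∁ (burning (run G r τ n)) ⊆ U ∪ covered τ V n
      saved⊆ {v} i with v ∈? U
      ... | yes ∈U = x∈p∪q⁺ (inj₁ ∈U)
      -- A vertex outside `U` has burnt, hence lies in the component of `r`, where
      -- `burns-or-covered` applies.
      ... | no ∉U with ball⊆Reach t (burning⊆ball σ t (x∉∁p⇒x∈p ∉U))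
      ...   | Rv with burns-or-covered τ Rv
      ...     | inj₁ b = contradiction (burning-mono G r τ (dist≤ n Rv) b) (x∈∁p⇒x∉p i)
      ...     | inj₂ (s , p , p∈ , j) with ∈-subset⁻ (target? s p) j
      -- Since `s < dist p ≤ dist v ≤ n`, the charge falls into one of the `n` rounds that are
      -- counted.
      ...       | below , s<p = x∈p∪q⁺ (inj₂ (∈-covered τ V (<-≤-trans s<p (≤-trans (Below-dist below) (dist≤ n Rv)))
                  p∈ j (∉U ∘ claimed-unburnt n t)))

theorem4 : ∃ λ (A : OnlineAlg) →
    ∀ (n : ℕ) (G : Graph n) (r : Fin n) (f : ℕ → ℕ) →
    Cactus G → (∀ i → 2 ∣ f i) →
    Legal G r f (play A G r f) ×
    (∀ (σ : Strategy n) → Legal G r f σ →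
    SavedLe (unburnt G r σ) 3 (unburnt G r (play A G r f)))
theorem4 = algorithm , λ n G r f cactus even → Analysis.legal G r f cactus , λ _ → Analysis.competitive G r f even
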